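{- Let $n,m\ge 5$ be integers with $m\equiv 1\pmod 4$ and $n\equiv 3\pmod 4$. Then $\gamma_t(C_n\times C_m)\le\frac{(n+1)(m+1)}{4}-3$ and $\gamma_p(C_n\times C_m)\le\frac{(n+1)(m+1)}{4}-2$.
   Context: All graphs are finite, simple and undirected. $C_n$ denotes the cycle of order $n$ and $G\times H$ the Cartesian product of graphs. For a graph $G$ without isolated vertices: a set $D\subseteq V(G)$ is a total dominating set if every vertex of $G$ (including those in $D$) has a neighbour in $D$; $\gamma_t(G)$ is the minimum size of a total dominating set. A set $D\subseteq V(G)$ is a paired dominating set if every vertex outside $D$ has a neighbour in $D$ and the induced subgraph $G[D]$ has a perfect matching; $\gamma_p(G)$ is the minimum size of a paired dominating set. -}

module Defs where

open import Data.Fin using (Fin; toℕ; remQuot)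
open import Data.Fin.Subset using (Subset; _∈_; _∉_; ∣_∣)
import Data.Fin.Properties as Fin
open import Data.Nat using (ℕ; suc; _*_; _≤_; s≤s)
import Data.Nat.Properties as ℕ
open import Data.Product using (Σ; ∃-syntax; ∃!; _×_; _,_; proj₁; proj₂)
open import Data.Sum using (_⊎_; inj₁; inj₂; swap)
import Data.Sum as Sum
open import Function using (_on_)
open import Level using (Level)
open import Relation.Binary using (Decidable; Symmetric)
open import Relation.Binary.PropositionalEquality using (_≡_; refl; sym; trans; cong)
open import Relation.Nullary using (¬_)
open import Relation.Nullary.Decidable using (_×-dec_; _⊎-dec_)

record Graph (V : Set) : Set₁ where
  field
    Adj        : V → V → Set
    adj?       : Decidable Adj
    adj-sym    : Symmetric Adj
    adj-irrefl : ∀ {v} → ¬ Adj v v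

open Graph public using (Adj)

-- Next i j: j is the cyclic successor i + 1 mod n.
Next : ∀ {n} → Fin n → Fin n → Set
Next {n} i j = toℕ j ≡ suc (toℕ i) ⊎ (suc (toℕ i) ≡ n × toℕ j ≡ 0)

cycle : (n : ℕ) → 3 ≤ n → Graph (Fin n)
cycle n 3≤n = record
  { Adj        = λ i j → Next i j ⊎ Next j i
  ; adj?       = λ i j → next? i j ⊎-dec next? j i
  ; adj-sym    = swap
  ; adj-irrefl = Sum.[ next-irrefl 3≤n , next-irrefl 3≤n ]
  }
  where
  next? : Decidable (Next {n})
  next? i j = (toℕ j ℕ.≟ suc (toℕ i))
        ⊎-dec ((suc (toℕ i) ℕ.≟ n) ×-dec (toℕ j ℕ.≟ 0))

  next-irrefl : ∀ {n} → 3 ≤ n → {i : Fin n} → ¬ Next i i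
  next-irrefl _ (inj₁ i≡1+i) = ℕ.1+n≢n (sym i≡1+i)
  next-irrefl 3≤n (inj₂ (1+i≡n , i≡0)) with trans (sym 1+i≡n) (cong suc i≡0)
  next-irrefl (s≤s ()) (inj₂ _) | refl

-- Cartesian product; remQuot b : Fin (a * b) → Fin a × Fin b is the
-- library's bijection between Fin (a * b) and the pairs.
infixr 7 _□_
_□_ : ∀ {a b} → Graph (Fin a) → Graph (Fin b) → Graph (Fin (a * b))
_□_ {a} {b} G H = record
  { Adj        = AdjP on remQuot b
  ; adj?       = λ x y → adjP? (remQuot b x) (remQuot b y)
  ; adj-sym    = Sum.map (λ (e , h) → sym e , H.adj-sym h)
                         (λ (e , g) → sym e , G.adj-sym g)
  ; adj-irrefl = Sum.[ (λ (_ , h) → H.adj-irrefl h)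
                     , (λ (_ , g) → G.adj-irrefl g) ]
  }
  where
  module G = Graph G
  module H = Graph H

  AdjP : Fin a × Fin b → Fin a × Fin b → Set
  AdjP (u , v) (u′ , v′) = (u ≡ u′ × H.Adj v v′) ⊎ (v ≡ v′ × G.Adj u u′)

  adjP? : Decidable AdjP
  adjP? (u , v) (u′ , v′) = ((u Fin.≟ u′) ×-dec H.adj? v v′)
                      ⊎-dec ((v Fin.≟ v′) ×-dec G.adj? u u′)

induced : ∀ {n} → Graph (Fin n) → (D : Subset n) → Graph (Σ (Fin n) (_∈ D))
induced G D = record
  { Adj        = G.Adj on proj₁
  ; adj?       = λ u v → G.adj? (proj₁ u) (proj₁ v)
  ; adj-sym    = G.adj-sym
  ; adj-irrefl = G.adj-irrefl
  }
  where module G = Graph G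

-- A set of edges, given as a symmetric subrelation of adjacency, such that
-- every vertex lies on exactly one of them.
record PerfectMatching {V : Set} (G : Graph V) : Set₁ where
  field
    Matched     : V → V → Set
    matched-sym : Symmetric Matched
    matched⇒adj : ∀ {u v} → Matched u v → Adj G u v
    matched-∃!  : ∀ u → ∃! _≡_ (Matched u)

module _ {n : ℕ} (G : Graph (Fin n)) where

  TotalDominating : Subset n → Set
  TotalDominating D = ∀ v → ∃[ u ] u ∈ D × Adj G v u

  PairedDominating : Subset n → Set₁
  PairedDominating D = (∀ v → v ∉ D → ∃[ u ] u ∈ D × Adj G v u)
                     × PerfectMatching (induced G D)

IsMinimumSize : ∀ {ℓ : Level} {n} → (Subset n → Set ℓ) → ℕ → Set ℓ
IsMinimumSize P k = (∃[ D ] P D × ∣ D ∣ ≡ k) × (∀ D → P D → k ≤ ∣ D ∣)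

-- γₜ and γₚ are relations rather than functions: γₜ[ G ]≡ k reads
-- “k is the minimum size of a total dominating set of G”.
infix 4 γₜ[_]≡_ γₚ[_]≡_
γₜ[_]≡_ : ∀ {n} → Graph (Fin n) → ℕ → Set
γₜ[ G ]≡ k = IsMinimumSize (TotalDominating G) k

γₚ[_]≡_ : ∀ {n} → Graph (Fin n) → ℕ → Set₁
γₚ[ G ]≡ k = IsMinimumSize (PairedDominating G) k

{-# OPTIONS --safe #-}
-- Over Cₙ □ Cₘ with n = 7 + 4a, m = 5 + 4b we lay out one 11 × 9 pattern whose
-- last four rows are repeated a times and whose last four columns are repeated
-- b times (zero repetitions included). Its four blocks of sizes 7 × 5, 7 × 4,
-- 4 × 5, 4 × 4 contain 9, 8, 6, 4 vertices, and
-- 9 + 8b + 6a + 4ab = (n + 1)(m + 1)/4 − 3.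
-- Domination is a finite check: a vertex only sees the pattern positions next
-- to its own, where a block of four may be followed by itself, be skipped, or
-- wrap around. The set is partitioned into adjacent pairs and one path on three
-- vertices; a further vertex attached to an end of that path completes the
-- perfect matching.
module Submission where

open import Defs
open import Data.Bool using (Bool; true; false; if_then_else_)
import Data.Bool.Properties as Bool
open import Data.Fin using (Fin; zero; suc; toℕ; fromℕ; inject₁; _↑ˡ_; _↑ʳ_;
  remQuot; combine; opposite; finToFun; funToFin)
open import Data.Fin.Patterns using (0F; 1F; 2F; 3F)
import Data.Fin.Properties as Fin
open import Data.Fin.Relation.Unary.Top using (view; ‵fromℕ; ‵inject₁)
open import Data.Fin.Subset using (Subset; _∈_; ∣_∣)
open import Data.Fin.Subset.Properties using (_∈?_; anySubset?)
open import Data.Maybe using (Maybe; just; nothing; is-just)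
import Data.Maybe.Properties as Maybe
open import Data.Nat using (ℕ; zero; suc; _+_; _*_; _∸_; _≤_; _<_; _<?_; _/_; _%_; s≤s)
open import Data.Nat.DivMod using (m≡m%n+[m/n]*n; m*n/n≡m)
open import Data.Nat.Induction using (<-wellFounded)
open import Data.Nat.Properties using (≤-trans; ≤-reflexive; ≤-refl; <⇒≤; ≮⇒≥; m≤m+n;
  m+n∸m≡n; +-assoc; *-zeroʳ; suc-injective; <-irrefl; _≟_)
open import Data.Nat.Tactic.RingSolver using (solve-∀)
open import Data.Product using (∃-syntax; ∃; _×_; _,_; proj₁; proj₂; uncurry)
open import Data.Sum using (_⊎_; inj₁; inj₂)
import Data.Sum as Sum
open import Data.Vec using (Vec; []; _∷_; lookup; sum; tabulate)
open import Data.Vec.Properties using ([]=⇒lookup; lookup⇒[]=; lookup∘tabulate; tabulate-cong)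
open import Data.Vec.Properties.WithK using ([]=-irrelevant)
open import Function using (_∘_)
open import Induction.WellFounded using (Acc; acc)
open import Level using (Level)
open import Relation.Binary using (Decidable)
open import Relation.Binary.PropositionalEquality
  using (_≡_; refl; sym; trans; cong; cong₂; subst; module ≡-Reasoning)
open import Relation.Nullary using (Dec; yes; no; contradiction)
open import Relation.Nullary.Decidable using (map′; from-yes; _×-dec_; _⊎-dec_; _→-dec_; ¬?)

-- Existence of the two minimum sizes: decidability of both kinds of domination.

private variable
  ℓ : Level
  n : ℕ

-- Since `γₜ` and `γₚ` are relations, an upper bound needs a minimum to exist. As `P` is decidable,
-- all subsets can be searched for a smaller witness; the descent on sizes ends at a minimum.
minimumSize : {P : Subset n → Set ℓ} → (∀ D → Dec (P D)) →
              ∀ D → P D → ∃[ k ] IsMinimumSize P k × k ≤ ∣ D ∣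
minimumSize {P = P} P? D₀ pD₀ = descend D₀ pD₀ (<-wellFounded _)
  where
  descend : ∀ D → P D → Acc _<_ ∣ D ∣ → ∃[ k ] IsMinimumSize P k × k ≤ ∣ D ∣
  descend D pD (acc smaller)
    with anySubset? (λ E → P? E ×-dec (∣ E ∣ <? ∣ D ∣))
  ... | yes (E , pE , E<D) = let k , kmin , k≤E = descend E pE (smaller E<D)
                             in k , kmin , ≤-trans k≤E (<⇒≤ E<D)
  ... | no none = ∣ D ∣ , ((D , pD , refl) , λ E pE → ≮⇒≥ λ E<D → none (E , pE , E<D)) , ≤-refl

module _ (G : Graph (Fin n)) where

  module G = Graph G

  totalDominating? : ∀ D → Dec (TotalDominating G D)
  totalDominating? D = Fin.all? λ v → Fin.any? λ u → (u ∈? D) ×-dec G.adj? v u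

  -- A perfect matching recast as an involution on `D`, with arbitrary values outside `D`. In this
  -- form the candidates are finite in number and can be searched.
  Pairing : Subset n → (Fin n → Fin n) → Set
  Pairing D f = ∀ u → u ∈ D → f u ∈ D × f (f u) ≡ u × Adj G u (f u)

  pairing⇒matching : ∀ {D f} → Pairing D f → PerfectMatching (induced G D)
  pairing⇒matching {D} {f} pairing = record
    { Matched     = λ u v → f (proj₁ u) ≡ proj₁ v
    ; matched-sym = λ { {u , u∈D} refl → proj₁ (proj₂ (pairing u u∈D)) }
    ; matched⇒adj = λ { {u , u∈D} refl → proj₂ (proj₂ (pairing u u∈D)) }
    ; matched-∃!  = λ (u , u∈D) → (f u , proj₁ (pairing u u∈D)) , refl ,
        λ { refl → cong (_ ,_) ([]=-irrelevant _ _) }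
    }

  matching⇒pairing : ∀ {D} → PerfectMatching (induced G D) → ∃ (Pairing D)
  matching⇒pairing {D} M = f , pairing
    where
    open PerfectMatching M

    f : Fin n → Fin n
    f u with u ∈? D
    ... | yes u∈D = proj₁ (proj₁ (matched-∃! (u , u∈D)))
    ... | no  _   = u

    f-unique : ∀ {u v} (u∈D : u ∈ D) (v∈D : v ∈ D) →
               Matched (u , u∈D) (v , v∈D) → f u ≡ v
    f-unique {u} u∈D v∈D uv with u ∈? D
    ... | no  u∉D = contradiction u∈D u∉D
    -- The matching lives on vertices bundled with membership proofs, so the proof found by `∈?`
    -- must be identified with the given one.
    ... | yes u∈D′ rewrite []=-irrelevant u∈D u∈D′ =
      cong proj₁ (proj₂ (proj₂ (matched-∃! (u , u∈D′))) uv)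

    pairing : Pairing D f
    pairing u u∈D with matched-∃! (u , u∈D)
    ... | (v , v∈D) , uv , _ rewrite f-unique u∈D v∈D uv =
      v∈D , f-unique v∈D u∈D (matched-sym uv) , matched⇒adj uv

  pairing? : ∀ D f → Dec (Pairing D f)
  pairing? D f = Fin.all? λ u → (u ∈? D) →-dec
    ((f u ∈? D) ×-dec ((f (f u) Fin.≟ u) ×-dec G.adj? u (f u)))

  -- Exhaustive search over the codes of all functions `Fin n → Fin n`. Decoding a code recovers its
  -- function only pointwise, hence `respect`.
  perfectMatching? : ∀ D → Dec (PerfectMatching (induced G D))
  perfectMatching? D = map′
    (λ (_ , pairing) → pairing⇒matching pairing)
    (λ M → let f , pairing = matching⇒pairing M
           in funToFin f , respect (λ u → sym (Fin.finToFun-funToFin f u)) pairing)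
    (Fin.any? λ c → pairing? D (finToFun {n} {n} c))
    where
    respect : ∀ {f g} → (∀ u → f u ≡ g u) → Pairing D f → Pairing D g
    respect {f} {g} f≗g pairing u u∈D with pairing u u∈D
    ... | fu∈D , ffu≡u , adj rewrite f≗g u | f≗g (g u) = fu∈D , ffu≡u , adj

  pairedDominating? : ∀ D → Dec (PairedDominating G D)
  pairedDominating? D =
    (Fin.all? λ v → ¬? (v ∈? D) →-dec Fin.any? λ u → (u ∈? D) ×-dec G.adj? v u)
    ×-dec perfectMatching? D

-- Successor and predecessor on a cycle.

∃next : (i : Fin n) → ∃ (Next i)
∃next i with view i
... | ‵fromℕ     = zero , inj₂ (cong suc (Fin.toℕ-fromℕ _) , refl)
... | ‵inject₁ j = suc j , inj₁ (cong suc (sym (Fin.toℕ-inject₁ j)))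

∃prev : (i : Fin n) → ∃[ j ] Next j i
∃prev zero    = fromℕ _ , inj₂ (cong suc (Fin.toℕ-fromℕ _) , refl)
∃prev (suc j) = inject₁ j , inj₁ (cong suc (sym (Fin.toℕ-inject₁ j)))

next-functional : {i j k : Fin n} → Next i j → Next i k → j ≡ k
next-functional (inj₁ j≡) (inj₁ k≡) = Fin.toℕ-injective (trans j≡ (sym k≡))
next-functional {j = j} (inj₁ j≡) (inj₂ (top , _)) =
  contradiction (Fin.toℕ<n j) (<-irrefl (trans j≡ top))
next-functional {k = k} (inj₂ (top , _)) (inj₁ k≡) =
  contradiction (Fin.toℕ<n k) (<-irrefl (trans k≡ top))
next-functional (inj₂ (_ , j≡)) (inj₂ (_ , k≡)) = Fin.toℕ-injective (trans j≡ (sym k≡))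

next-injective : {i j k : Fin n} → Next i k → Next j k → i ≡ j
next-injective (inj₁ k≡) (inj₁ k≡′) = Fin.toℕ-injective (suc-injective (trans (sym k≡) k≡′))
next-injective (inj₁ k≡) (inj₂ (_ , k≡0)) with () ← trans (sym k≡) k≡0
next-injective (inj₂ (_ , k≡0)) (inj₁ k≡) with () ← trans (sym k≡0) k≡
next-injective (inj₂ (top , _)) (inj₂ (top′ , _)) =
  Fin.toℕ-injective (suc-injective (trans top (sym top′)))

next prev : Fin n → Fin n
next i = proj₁ (∃next i)
prev i = proj₁ (∃prev i)

prev-next : (i : Fin n) → prev (next i) ≡ i
prev-next i = next-injective (proj₂ (∃prev (next i))) (proj₂ (∃next i))

next-prev : (i : Fin n) → next (prev i) ≡ i
next-prev i = next-functional (proj₂ (∃next (prev i))) (proj₂ (∃prev i))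

-- Folding a cycle of length p + 4a onto p + 4 pattern positions.

-- fold p k is k for k < p + 4, and beyond that is reduced modulo 4 into the
-- last four positions p, …, p + 3.
fold : ∀ p → ℕ → Fin (p + 4)
fold zero 0 = 0F
fold zero 1 = 1F
fold zero 2 = 2F
fold zero 3 = 3F
fold zero (suc (suc (suc (suc k)))) = fold zero k
fold (suc p) zero    = zero
fold (suc p) (suc k) = suc (fold p k)

-- `Step` collects the images of successor pairs for all numbers of repetitions at once, so it does
-- not mention `a`. In `End`, position p - 1 is the last one when the block is skipped, and p + 3
-- otherwise.
Advance End Step : ∀ p → Fin (p + 4) → Fin (p + 4) → Set
Advance p s t = toℕ t ≡ suc (toℕ s) ⊎ (suc (toℕ s) ≡ p + 4 × toℕ t ≡ p)
End     p s t = (suc (toℕ s) ≡ p ⊎ suc (toℕ s) ≡ p + 4) × toℕ t ≡ 0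
Step    p s t = Advance p s t ⊎ End p s t

step? : ∀ p → Decidable (Step p)
step? p s t =
  ((toℕ t ≟ suc (toℕ s)) ⊎-dec ((suc (toℕ s) ≟ p + 4) ×-dec (toℕ t ≟ p)))
  ⊎-dec (((suc (toℕ s) ≟ p) ⊎-dec (suc (toℕ s) ≟ p + 4)) ×-dec (toℕ t ≟ 0))

fold-zero : ∀ p → toℕ (fold p 0) ≡ 0
fold-zero zero    = refl
fold-zero (suc p) = refl

fold-advance : ∀ p k → Advance p (fold p k) (fold p (suc k))
fold-advance zero 0 = inj₁ refl
fold-advance zero 1 = inj₁ refl
fold-advance zero 2 = inj₁ refl
fold-advance zero 3 = inj₂ (refl , refl)
fold-advance zero (suc (suc (suc (suc k)))) = fold-advance zero k
fold-advance (suc p) zero    = inj₁ (cong suc (fold-zero p))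
fold-advance (suc p) (suc k) =
  Sum.map (cong suc) (λ (s≡ , t≡) → cong suc s≡ , cong suc t≡) (fold-advance p k)

fold-last : ∀ p a k → suc k ≡ p + a * 4 →
            suc (toℕ (fold p k)) ≡ p ⊎ suc (toℕ (fold p k)) ≡ p + 4
fold-last zero (suc zero)    _ refl = inj₂ refl
fold-last zero (suc (suc a)) (suc (suc (suc (suc k)))) eq =
  fold-last zero (suc a) k (suc-injective (suc-injective (suc-injective (suc-injective eq))))
fold-last (suc zero)    a zero    _  = inj₁ refl
fold-last (suc p) a (suc k) eq =
  Sum.map (cong suc) (cong suc) (fold-last p a k (suc-injective eq))

RespectsNext : (n p : ℕ) → Set
RespectsNext n p = ∀ {i j : Fin n} → Next i j → Step p (fold p (toℕ i)) (fold p (toℕ j))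

next⇒step : ∀ p a → RespectsNext (p + a * 4) p
next⇒step p a {i} (inj₁ j≡) rewrite j≡ = inj₁ (fold-advance p (toℕ i))
next⇒step p a {i} (inj₂ (top , j≡0)) rewrite j≡0 =
  inj₂ (fold-last p a (toℕ i) top , fold-zero p)

-- Sums over folded positions and cardinalities of grid subsets.

∑< : ℕ → (ℕ → ℕ) → ℕ
∑< zero    w = 0
∑< (suc n) w = w 0 + ∑< n (w ∘ suc)

∑<-cong : ∀ n {v w : ℕ → ℕ} → (∀ k → v k ≡ w k) → ∑< n v ≡ ∑< n w
∑<-cong zero    v≗w = refl
∑<-cong (suc n) v≗w = cong₂ _+_ (v≗w 0) (∑<-cong n (v≗w ∘ suc))

∑ : (Fin n → ℕ) → ℕ
∑ w = sum (tabulate w)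

∑-linear : ∀ n b (v w : Fin n → ℕ) → ∑ (λ i → v i + b * w i) ≡ ∑ v + b * ∑ w
∑-linear zero    b v w = sym (*-zeroʳ b)
∑-linear (suc n) b v w rewrite ∑-linear n b (v ∘ suc) (w ∘ suc) =
  regroup (v zero) (w zero) (∑ (v ∘ suc)) (∑ (w ∘ suc)) b
  where
  regroup : ∀ x y X Y b → (x + b * y) + (X + b * Y) ≡ (x + X) + b * (y + Y)
  regroup = solve-∀

base : ∀ p → Fin p → Fin (p + 4)
base p i = i ↑ˡ 4

block : ∀ p → Fin 4 → Fin (p + 4)
block p i = p ↑ʳ i

-- Each base position is the image of one index, each block position of `a` indices.
∑-fold : ∀ p a (w : Fin (p + 4) → ℕ) →
         ∑< (p + a * 4) (w ∘ fold p) ≡ ∑ (w ∘ base p) + a * ∑ (w ∘ block p)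
∑-fold zero zero    w = refl
∑-fold zero (suc a) w rewrite ∑-fold zero a w =
  regroup (w 0F) (w 1F) (w 2F) (w 3F) (a * ∑ w)
  where
  regroup : ∀ x₀ x₁ x₂ x₃ y →
    x₀ + (x₁ + (x₂ + (x₃ + y))) ≡ (x₀ + (x₁ + (x₂ + (x₃ + 0)))) + y
  regroup = solve-∀
∑-fold (suc p) a w rewrite ∑-fold p a (w ∘ suc) = sym (+-assoc (w zero) _ _)

bit : Bool → ℕ
bit b = if b then 1 else 0

∣tabulate∣-+ : ∀ m n (f : Fin (m + n) → Bool) →
  ∣ tabulate f ∣ ≡ ∣ tabulate (λ i → f (i ↑ˡ n)) ∣ + ∣ tabulate (λ i → f (m ↑ʳ i)) ∣
∣tabulate∣-+ zero    n f = refl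
∣tabulate∣-+ (suc m) n f with f zero
... | true  = cong suc (∣tabulate∣-+ m n (f ∘ suc))
... | false = ∣tabulate∣-+ m n (f ∘ suc)

∣tabulate∣-cong : {f g : Fin n → Bool} → (∀ i → f i ≡ g i) → ∣ tabulate f ∣ ≡ ∣ tabulate g ∣
∣tabulate∣-cong f≗g = cong ∣_∣ (tabulate-cong f≗g)

∣tabulate∣-∑ : ∀ n (f : ℕ → Bool) → ∣ tabulate {n = n} (f ∘ toℕ) ∣ ≡ ∑< n (bit ∘ f)
∣tabulate∣-∑ zero    f = refl
∣tabulate∣-∑ (suc n) f with f 0
... | true  = cong suc (∣tabulate∣-∑ n (f ∘ suc))
... | false = ∣tabulate∣-∑ n (f ∘ suc)

-- The predicate takes natural numbers so that deleting the first row becomes the shift `F ∘ suc`.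
gridSet : ∀ n m → (ℕ → ℕ → Bool) → Subset (n * m)
gridSet n m F = tabulate λ x → F (toℕ (proj₁ (remQuot {n} m x))) (toℕ (proj₂ (remQuot {n} m x)))

-- Induction on rows: `remQuot` numbers the vertices row by row, so the first `m` indices form row
-- 0.
∣gridSet∣ : ∀ n m F → ∣ gridSet n m F ∣ ≡ ∑< n (λ i → ∑< m (λ j → bit (F i j)))
∣gridSet∣ zero    m F = refl
∣gridSet∣ (suc n) m F = begin
  ∣ gridSet (suc n) m F ∣
    ≡⟨ ∣tabulate∣-+ m (n * m) at ⟩
  ∣ tabulate (λ j → at (j ↑ˡ (n * m))) ∣ + ∣ tabulate (λ x → at (m ↑ʳ x)) ∣
    ≡⟨ cong₂ _+_ (∣tabulate∣-cong firstRow) (∣tabulate∣-cong laterRows) ⟩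
  ∣ tabulate {n = m} (F 0 ∘ toℕ) ∣ + ∣ gridSet n m (F ∘ suc) ∣
    ≡⟨ cong₂ _+_ (∣tabulate∣-∑ m (F 0)) (∣gridSet∣ n m (F ∘ suc)) ⟩
  ∑< (suc n) (λ i → ∑< m (λ j → bit (F i j))) ∎
  where
  open ≡-Reasoning

  at : Fin (suc n * m) → Bool
  at x = F (toℕ (proj₁ (remQuot {suc n} m x))) (toℕ (proj₂ (remQuot {suc n} m x)))

  firstRow : ∀ j → at (j ↑ˡ (n * m)) ≡ F 0 (toℕ j)
  firstRow j rewrite Fin.splitAt-↑ˡ m j (n * m) = refl

  laterRows : ∀ x → at (m ↑ʳ x) ≡
              F (suc (toℕ (proj₁ (remQuot {n} m x)))) (toℕ (proj₂ (remQuot {n} m x)))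
  laterRows x rewrite Fin.splitAt-↑ʳ m (n * m) x = refl

∈-tabulate⁺ : (f : Fin n → Bool) {x : Fin n} → f x ≡ true → x ∈ tabulate f
∈-tabulate⁺ f {x} fx = lookup⇒[]= x (tabulate f) (trans (lookup∘tabulate f x) fx)

∈-tabulate⁻ : (f : Fin n → Bool) {x : Fin n} → x ∈ tabulate f → f x ≡ true
∈-tabulate⁻ f {x} x∈ = trans (sym (lookup∘tabulate f x)) ([]=⇒lookup x∈)

-- The pattern and its finite checks.

-- The numbering makes Data.Fin.opposite the reversal of directions.
pattern east  = 0F
pattern south = 1F
pattern north = 2F
pattern west  = 3F

-- A triangle is a vertex of the paired dominating set and points to its
-- partner; the hollow one is left out of the total dominating set.
data Cell : Set where
  ◦ ▸ ▾ ▴ ◂ ◃ : Cell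

partner : Cell → Maybe (Fin 4)
partner ◦ = nothing
partner ▸ = just east
partner ▾ = just south
partner ▴ = just north
partner ◂ = just west
partner ◃ = just west

inPaired inTotal : Cell → Bool
inPaired = is-just ∘ partner
inTotal ◃ = false
inTotal c = inPaired c

inTotal⇒inPaired : ∀ c → inTotal c ≡ true → inPaired c ≡ true
inTotal⇒inPaired ▸ _ = refl
inTotal⇒inPaired ▾ _ = refl
inTotal⇒inPaired ▴ _ = refl
inTotal⇒inPaired ◂ _ = refl

-- The gaps set off the repeated last four rows and columns. The path on three vertices starts the
-- third row, and the hollow cell is the mate of its right end.
pattern₁₁ₓ₉ : Vec (Vec Cell 9) 11
pattern₁₁ₓ₉ =
  (◦ ∷ ◦ ∷ ◦ ∷ ▸ ∷ ◂ ∷   ◦ ∷ ◦ ∷ ▸ ∷ ◂ ∷ []) ∷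
  (◦ ∷ ◦ ∷ ◦ ∷ ◦ ∷ ◦ ∷   ◦ ∷ ◦ ∷ ◦ ∷ ◦ ∷ []) ∷
  (▸ ∷ ◂ ∷ ▸ ∷ ◃ ∷ ◦ ∷   ▸ ∷ ◂ ∷ ◦ ∷ ◦ ∷ []) ∷
  (◦ ∷ ◦ ∷ ◦ ∷ ◦ ∷ ◦ ∷   ◦ ∷ ◦ ∷ ◦ ∷ ◦ ∷ []) ∷
  (◦ ∷ ◦ ∷ ◦ ∷ ▸ ∷ ◂ ∷   ◦ ∷ ◦ ∷ ▸ ∷ ◂ ∷ []) ∷
  (◦ ∷ ▾ ∷ ◦ ∷ ◦ ∷ ◦ ∷   ◦ ∷ ◦ ∷ ◦ ∷ ◦ ∷ []) ∷
  (◦ ∷ ▴ ∷ ◦ ∷ ◦ ∷ ◦ ∷   ▸ ∷ ◂ ∷ ◦ ∷ ◦ ∷ []) ∷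

  (◦ ∷ ◦ ∷ ◦ ∷ ▸ ∷ ◂ ∷   ◦ ∷ ◦ ∷ ◦ ∷ ▾ ∷ []) ∷
  (◦ ∷ ◦ ∷ ◦ ∷ ▸ ∷ ◂ ∷   ◦ ∷ ◦ ∷ ◦ ∷ ▴ ∷ []) ∷
  (◦ ∷ ▾ ∷ ◦ ∷ ◦ ∷ ◦ ∷   ◦ ∷ ▾ ∷ ◦ ∷ ◦ ∷ []) ∷
  (◦ ∷ ▴ ∷ ◦ ∷ ◦ ∷ ◦ ∷   ◦ ∷ ▴ ∷ ◦ ∷ ◦ ∷ []) ∷ []

cell : Fin 11 → Fin 9 → Cell
cell r c = lookup (lookup pattern₁₁ₓ₉ r) c

T : Fin 11 → Fin 9 → Set
T r c = inTotal (cell r c) ≡ true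

T? : Decidable T
T? r c = inTotal (cell r c) Bool.≟ true

abstract
  -- Quantifying over every `Step` before and after a position covers all tori in one check. Cells
  -- of the set itself are included, as total domination requires. Each `Step` premise precedes the
  -- next quantifier, which prunes the search.
  pattern-dominates : ∀ r r⁻ → Step 7 r⁻ r → ∀ r⁺ → Step 7 r r⁺ →
                      ∀ c c⁻ → Step 5 c⁻ c → ∀ c⁺ → Step 5 c c⁺ →
                      (T r c⁻ ⊎ T r c⁺) ⊎ (T r⁻ c ⊎ T r⁺ c)
  pattern-dominates = from-yes
    (Fin.all? λ r → Fin.all? λ r⁻ → step? 7 r⁻ r →-dec Fin.all? λ r⁺ → step? 7 r r⁺ →-dec
     Fin.all? λ c → Fin.all? λ c⁻ → step? 5 c⁻ c →-dec Fin.all? λ c⁺ → step? 5 c c⁺ →-dec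
     ((T? r c⁻ ⊎-dec T? r c⁺) ⊎-dec (T? r⁻ c ⊎-dec T? r⁺ c)))

_pointsTo_ : Cell → Fin 4 → Set
c pointsTo d = partner c ≡ just d

pointsTo? : ∀ c d → Dec (c pointsTo d)
pointsTo? c d = Maybe.≡-dec Fin._≟_ (partner c) (just d)

abstract
  -- No pair is cut at a seam, whichever `Step` is taken there. The two implications serve the
  -- partners to the east and to the west respectively.
  pattern-matches-rows : ∀ r c c′ → Step 5 c c′ →
    (cell r c pointsTo east → cell r c′ pointsTo west) ×
    (cell r c′ pointsTo west → cell r c pointsTo east)
  pattern-matches-rows = from-yes
    (Fin.all? λ r → Fin.all? λ c → Fin.all? λ c′ → step? 5 c c′ →-dec
      ((pointsTo? (cell r c) east →-dec pointsTo? (cell r c′) west) ×-dec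
       (pointsTo? (cell r c′) west →-dec pointsTo? (cell r c) east)))

  pattern-matches-columns : ∀ c r r′ → Step 7 r r′ →
    (cell r c pointsTo south → cell r′ c pointsTo north) ×
    (cell r′ c pointsTo north → cell r c pointsTo south)
  pattern-matches-columns = from-yes
    (Fin.all? λ c → Fin.all? λ r → Fin.all? λ r′ → step? 7 r r′ →-dec
      ((pointsTo? (cell r c) south →-dec pointsTo? (cell r′ c) north) ×-dec
       (pointsTo? (cell r′ c) north →-dec pointsTo? (cell r c) south)))

-- Sizes of the sets cut out by the pattern.

selected : ∀ n m → (Cell → Bool) → Subset (n * m)
selected n m s = gridSet n m λ i j → s (cell (fold 7 i) (fold 5 j))

blockSize : (Cell → Bool) → ∀ {p q} → (Fin p → Fin 11) → (Fin q → Fin 9) → ℕ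
blockSize s rs cs = ∑ λ i → ∑ λ j → bit (s (cell (rs i) (cs j)))

-- `∑-fold` is applied to the columns of each row and then to the rows, so the four blocks get
-- weights 1, b, a and ab.
∣selected∣ : ∀ a b s → ∣ selected (7 + a * 4) (5 + b * 4) s ∣ ≡
  (blockSize s (base 7) (base 5) + b * blockSize s (base 7) (block 5)) +
  a * (blockSize s (block 7) (base 5) + b * blockSize s (block 7) (block 5))
∣selected∣ a b s = begin
  ∣ selected rows columns s ∣
    ≡⟨ ∣gridSet∣ rows columns (λ i j → s (cell (fold 7 i) (fold 5 j))) ⟩
  ∑< rows (λ i → ∑< columns (λ j → bit (s (cell (fold 7 i) (fold 5 j)))))
    ≡⟨ ∑<-cong rows (λ i → ∑-fold 5 b (λ c → bit (s (cell (fold 7 i) c)))) ⟩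
  ∑< rows (λ i → left (fold 7 i) + b * right (fold 7 i))
    ≡⟨ ∑-fold 7 a (λ r → left r + b * right r) ⟩
  ∑ (λ i → left (base 7 i) + b * right (base 7 i)) +
  a * ∑ (λ i → left (block 7 i) + b * right (block 7 i))
    ≡⟨ cong₂ (λ x y → x + a * y) (∑-linear 7 b (left ∘ base 7) (right ∘ base 7))
                                 (∑-linear 4 b (left ∘ block 7) (right ∘ block 7)) ⟩
  _ ∎
  where
  open ≡-Reasoning

  rows columns : ℕ
  rows    = 7 + a * 4
  columns = 5 + b * 4

  left right : Fin 11 → ℕ
  left  r = ∑ λ j → bit (s (cell r (base 5 j)))
  right r = ∑ λ j → bit (s (cell r (block 5 j)))

-- Transfer from the pattern to the torus.

module Torus (rows columns : ℕ) (3≤n : 3 ≤ rows) (3≤m : 3 ≤ columns)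
             (row-step : RespectsNext rows 7) (column-step : RespectsNext columns 5) where

  G : Graph (Fin (rows * columns))
  G = cycle rows 3≤n □ cycle columns 3≤m

  Position : Set
  Position = Fin rows × Fin columns

  cellAt : Position → Cell
  cellAt (i , j) = cell (fold 7 (toℕ i)) (fold 5 (toℕ j))

  position : Fin (rows * columns) → Position
  position = remQuot columns

  vertex : Position → Fin (rows * columns)
  vertex = uncurry combine

  position-vertex : ∀ x → position (vertex x) ≡ x
  position-vertex (i , j) = Fin.remQuot-combine i j

  ∈-selected⁺ : ∀ s {v} → s (cellAt (position v)) ≡ true → v ∈ selected rows columns s
  ∈-selected⁺ s = ∈-tabulate⁺ (s ∘ cellAt ∘ position)

  ∈-selected⁻ : ∀ s {v} → v ∈ selected rows columns s → s (cellAt (position v)) ≡ true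
  ∈-selected⁻ s = ∈-tabulate⁻ (s ∘ cellAt ∘ position)

  vertex∈selected : ∀ s x → s (cellAt x) ≡ true → vertex x ∈ selected rows columns s
  vertex∈selected s x sx =
    ∈-selected⁺ s {vertex x} (subst (λ y → s (cellAt y) ≡ true) (sym (position-vertex x)) sx)

  move : Fin 4 → Position → Position
  move east  (i , j) = i , next j
  move south (i , j) = next i , j
  move north (i , j) = prev i , j
  move west  (i , j) = i , prev j

  move-opposite : ∀ d x → move (opposite d) (move d x) ≡ x
  move-opposite east  (i , j) = cong (i ,_) (prev-next j)
  move-opposite south (i , j) = cong (_, j) (prev-next i)
  move-opposite north (i , j) = cong (_, j) (next-prev i)
  move-opposite west  (i , j) = cong (i ,_) (next-prev j)

  -- This is what `Adj G` unfolds to on positions, so adjacency can be transported along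
  -- `position-vertex`.
  Neighbours : Position → Position → Set
  Neighbours (i , j) (i′ , j′) = (i ≡ i′ × (Next j j′ ⊎ Next j′ j))
                               ⊎ (j ≡ j′ × (Next i i′ ⊎ Next i′ i))

  move-neighbours : ∀ d x → Neighbours x (move d x)
  move-neighbours east  (i , j) = inj₁ (refl , inj₁ (proj₂ (∃next j)))
  move-neighbours south (i , j) = inj₂ (refl , inj₁ (proj₂ (∃next i)))
  move-neighbours north (i , j) = inj₂ (refl , inj₂ (proj₂ (∃prev i)))
  move-neighbours west  (i , j) = inj₁ (refl , inj₂ (proj₂ (∃prev j)))

  move-adj : ∀ d v → Adj G v (vertex (move d (position v)))
  move-adj d v = subst (Neighbours (position v)) (sym (position-vertex (move d (position v))))
                       (move-neighbours d (position v))

  neighbour-inTotal : ∀ x → ∃[ d ] inTotal (cellAt (move d x)) ≡ true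
  neighbour-inTotal (i , j)
    with pattern-dominates _ _ (row-step (proj₂ (∃prev i))) _ (row-step (proj₂ (∃next i)))
                           _ _ (column-step (proj₂ (∃prev j))) _ (column-step (proj₂ (∃next j)))
  ... | inj₁ (inj₁ t) = west  , t
  ... | inj₁ (inj₂ t) = east  , t
  ... | inj₂ (inj₁ t) = north , t
  ... | inj₂ (inj₂ t) = south , t

  totalSet pairedSet : Subset (rows * columns)
  totalSet  = selected rows columns inTotal
  pairedSet = selected rows columns inPaired

  -- Allowing any superset of the total dominating cells lets the same argument handle both sets.
  selected-totalDominating : ∀ s → (∀ c → inTotal c ≡ true → s c ≡ true) →
                             TotalDominating G (selected rows columns s)
  selected-totalDominating s T⊆s v =
    let d , t = neighbour-inTotal (position v)
        w     = move d (position v)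
    in vertex w , vertex∈selected s w (T⊆s (cellAt w) t) , move-adj d v

  partner-points-back : ∀ d x → cellAt x pointsTo d → cellAt (move d x) pointsTo (opposite d)
  partner-points-back east  (i , j) = proj₁ (pattern-matches-rows
    (fold 7 (toℕ i)) _ _ (column-step (proj₂ (∃next j))))
  partner-points-back south (i , j) = proj₁ (pattern-matches-columns
    (fold 5 (toℕ j)) _ _ (row-step (proj₂ (∃next i))))
  partner-points-back north (i , j) = proj₂ (pattern-matches-columns
    (fold 5 (toℕ j)) _ _ (row-step (proj₂ (∃prev i))))
  partner-points-back west  (i , j) = proj₂ (pattern-matches-rows
    (fold 7 (toℕ i)) _ _ (column-step (proj₂ (∃prev j))))

  follow : Maybe (Fin 4) → Position → Position
  -- Default for cells outside the paired set, where `Pairing` demands nothing.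
  follow nothing  x = x
  follow (just d) x = move d x

  mate : Fin (rows * columns) → Fin (rows * columns)
  mate v = vertex (follow (partner (cellAt (position v))) (position v))

  mate-pairing : Pairing G pairedSet mate
  mate-pairing v v∈ with partner (cellAt (position v)) in points | ∈-selected⁻ inPaired {v} v∈
  -- Membership in `pairedSet` rules out `nothing`. The partner points in the opposite direction, so
  -- following it leads back to `v`.
  ... | just d | _ = vertex∈selected inPaired w (cong is-just back) , mate-mate , move-adj d v
    where
    w = move d (position v)

    back : cellAt w pointsTo opposite d
    back = partner-points-back d (position v) points

    open ≡-Reasoning
    mate-mate : mate (vertex w) ≡ v
    mate-mate = begin
      mate (vertex w)
        ≡⟨ cong (λ y → vertex (follow (partner (cellAt y)) y)) (position-vertex w) ⟩
      vertex (follow (partner (cellAt w)) w)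
        ≡⟨ cong (λ p → vertex (follow p w)) back ⟩
      vertex (move (opposite d) w)
        ≡⟨ cong vertex (move-opposite d (position v)) ⟩
      vertex (position v)
        ≡⟨ Fin.combine-remQuot {rows} columns v ⟩
      v ∎

  pairedSet-pairedDominating : PairedDominating G pairedSet
  pairedSet-pairedDominating =
    (λ v _ → selected-totalDominating inPaired inTotal⇒inPaired v) , pairing⇒matching G mate-pairing

-- Arithmetic of the bounds and the conclusion.

k≡[s+k]*4/4∸s : ∀ s k {N} → N ≡ (s + k) * 4 → k ≡ N / 4 ∸ s
-- The division by 4 is exact and the truncated subtraction loses nothing.
k≡[s+k]*4/4∸s s k refl = sym (trans (cong (_∸ s) (m*n/n≡m (s + k) 4)) (m+n∸m≡n s k))

n≡7+4a : ∀ n → 5 ≤ n → n % 4 ≡ 3 → ∃[ a ] n ≡ 7 + a * 4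
n≡7+4a n 5≤n n%4 with n / 4 | m≡m%n+[m/n]*n n 4
... | q | n≡ rewrite n%4 with q
...   | suc a = a , n≡
-- Quotient 0 would give n = 3, which `5 ≤ n` excludes; quotient `suc a` gives 3 + 4(a + 1).
n≡7+4a .3 (s≤s (s≤s (s≤s ()))) _ | _ | refl | zero

m≡5+4b : ∀ m → 5 ≤ m → m % 4 ≡ 1 → ∃[ b ] m ≡ 5 + b * 4
m≡5+4b m 5≤m m%4 with m / 4 | m≡m%n+[m/n]*n m 4
... | q | m≡ rewrite m%4 with q
...   | suc b = b , m≡
m≡5+4b .1 (s≤s ()) _ | _ | refl | zero

theorem5p4 : (n m : ℕ) (5≤n : 5 ≤ n) (5≤m : 5 ≤ m) → m % 4 ≡ 1 → n % 4 ≡ 3 →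
    let G = cycle n (≤-trans (m≤m+n 3 2) 5≤n) □ cycle m (≤-trans (m≤m+n 3 2) 5≤m)
    in (∃[ k ] γₜ[ G ]≡ k × k ≤ ((n + 1) * (m + 1)) / 4 ∸ 3)
    × (∃[ k ] γₚ[ G ]≡ k × k ≤ ((n + 1) * (m + 1)) / 4 ∸ 2)
theorem5p4 n m 5≤n 5≤m m%4 n%4 with n≡7+4a n 5≤n n%4 | m≡5+4b m 5≤m m%4
... | a , refl | b , refl =
  (let k , γ , k≤ = minimumSize (totalDominating? G) totalSet
                      (selected-totalDominating inTotal λ _ t → t)
   in k , γ , ≤-trans k≤ (≤-reflexive (trans (∣selected∣ a b inTotal)
                (k≡[s+k]*4/4∸s 3 _ (totalCount a b))))) ,
  (let k , γ , k≤ = minimumSize (pairedDominating? G) pairedSet pairedSet-pairedDominating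
   in k , γ , ≤-trans k≤ (≤-reflexive (trans (∣selected∣ a b inPaired)
                (k≡[s+k]*4/4∸s 2 _ (pairedCount a b)))))
  where
  open Torus (7 + a * 4) (5 + b * 4) (≤-trans (m≤m+n 3 2) 5≤n) (≤-trans (m≤m+n 3 2) 5≤m)
             (next⇒step 7 a) (next⇒step 5 b)

  -- The numerals 9, 8, 6, 4 are the values of `blockSize`, found by evaluation. In `pairedCount`
  -- the hollow cell turns 9 into 10, so 2 is subtracted instead of 3.
  totalCount : ∀ a b → (7 + a * 4 + 1) * (5 + b * 4 + 1) ≡
                       (3 + ((9 + b * 8) + a * (6 + b * 4))) * 4
  totalCount = solve-∀

  pairedCount : ∀ a b → (7 + a * 4 + 1) * (5 + b * 4 + 1) ≡
                        (2 + ((10 + b * 8) + a * (6 + b * 4))) * 4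
  pairedCount = solve-∀
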